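{- Let $G$ and $H$ be directed graphs. Then there is a graph homomorphism from $G$ to $H$ if and only if there is a homomorphism of $2$-posets from $P_G$ to $P_H$.
   Context: A $k$-poset is an object $(P;\leq,c)$ where $(P;\leq)$ is a partially ordered set and $c\colon P\to\{0,1,\dots,k-1\}$ is a labeling function. A homomorphism of $k$-posets $h\colon(P;\leq,c)\to(P';\leq',c')$ is a map $h\colon P\to P'$ that preserves order ($x\leq y$ implies $h(x)\leq' h(y)$) and labels ($c=c'\circ h$). A directed graph is a pair $G=(V,E)$ with $E\subseteq V\times V$ (loops allowed; $V$ and $E$ are regarded as disjoint sets). A graph homomorphism $G\to H$ is a map $h\colon V(G)\to V(H)$ such that $(u,v)\in E(G)$ implies $(h(u),h(v))\in E(H)$. For a directed graph $G=(V,E)$, the $2$-poset $P_G=(P;\leq,c)$ is defined by $P=(V\cup E)\times\{0,1\}$, $c(a,b)=b$ for all $a\in V\cup E$, $b\in\{0,1\}$, and the covering relations of $\leq$ are exactly the following: $(a,0)<(a,1)$ for all $a\in V$; $(a,1)<(a,0)$ for all $a\in E$; and for each edge $(u,v)\in E$, $(u,0)<((u,v),0)$ and $((u,v),1)<(v,1)$. -}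

module Defs where

open import Data.Empty using (⊥-elim)
open import Data.Fin.Base using (Fin)
open import Data.Fin.Patterns using (0F; 1F)
open import Data.Nat.Base using (ℕ)
open import Data.Product.Base using (Σ; ∃-syntax; _×_; _,_; proj₂; uncurry)
open import Data.Sum.Base using (_⊎_; inj₁; inj₂)
open import Function.Bundles using (_⇔_; mk⇔)
open import Level using (Level; _⊔_; suc)
open import Relation.Binary.Bundles using (Poset)
open import Relation.Binary.Construct.Closure.ReflexiveTransitive using (Star; ε; _◅_)
import Relation.Binary.Construct.Closure.ReflexiveTransitive.Properties as Starₚ
import Relation.Binary.Construct.NonStrictToStrict as NonStrictToStrict
open import Relation.Binary.Core using (Rel)
open import Relation.Binary.Definitions using (Antisymmetric; Irrelevant)
open import Relation.Binary.Morphism.Bundles using (PosetHomomorphism)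
open import Relation.Binary.PropositionalEquality using (_≡_; refl; cong)
open import Relation.Nullary.Negation using (¬_)

private
  variable
    a b ℓ m p₁ p₂ p₃ q₁ q₂ q₃ : Level

-- The edges form a subset of V × V, so membership of a pair in that subset
-- is proof-irrelevant (there are no parallel edges).

record Digraph a ℓ : Set (suc (a ⊔ ℓ)) where
  field
    V          : Set a
    E          : Rel V ℓ
    irrelevant : Irrelevant E

  Edge : Set (a ⊔ ℓ)
  Edge = Σ (V × V) (uncurry E)

record GraphHomomorphism (G : Digraph a ℓ) (H : Digraph b m) : Set (a ⊔ ℓ ⊔ b ⊔ m) where
  private
    module G = Digraph G
    module H = Digraph H
  field
    ⟦_⟧  : G.V → H.V
    edge : ∀ {u v} → G.E u v → H.E ⟦ u ⟧ ⟦ v ⟧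

record LabelledPoset (k : ℕ) p₁ p₂ p₃ : Set (suc (p₁ ⊔ p₂ ⊔ p₃)) where
  field
    poset : Poset p₁ p₂ p₃
  open Poset poset public
  field
    label      : Carrier → Fin k
    label-cong : ∀ {x y} → x ≈ y → label x ≡ label y

record LabelledPosetHomomorphism {k : ℕ} (P : LabelledPoset k p₁ p₂ p₃)
                                 (Q : LabelledPoset k q₁ q₂ q₃)
                                 : Set (p₁ ⊔ p₂ ⊔ p₃ ⊔ q₁ ⊔ q₂ ⊔ q₃) where
  private
    module P = LabelledPoset P
    module Q = LabelledPoset Q
  field
    posetHomomorphism : PosetHomomorphism P.poset Q.poset
  open PosetHomomorphism posetHomomorphism public
  field
    label-preserving : ∀ x → P.label x ≡ Q.label ⟦ x ⟧

module _ (G : Digraph a ℓ) where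
  open Digraph G

  Point : Set (a ⊔ ℓ)
  Point = (V ⊎ Edge) × Fin 2

  data Cover : Rel Point (a ⊔ ℓ) where
    vertex : ∀ v → Cover (inj₁ v , 0F) (inj₁ v , 1F)
    edge   : ∀ e → Cover (inj₂ e , 1F) (inj₂ e , 0F)
    source : ∀ {u v} (e : E u v) → Cover (inj₁ u , 0F) (inj₂ ((u , v) , e) , 0F)
    target : ∀ {u v} (e : E u v) → Cover (inj₂ ((u , v) , e) , 1F) (inj₁ v , 1F)

  private
    no-chain : ∀ {x y z} → Cover x y → ¬ Cover y z
    no-chain (vertex v) ()
    no-chain (edge e)   ()
    no-chain (source e) ()
    no-chain (target e) ()

    irreflexive : ∀ {x} → ¬ Cover x x
    irreflexive ()

    antisym : Antisymmetric _≡_ (Star Cover)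
    antisym ε           _       = refl
    antisym (c ◅ ε)     ε       = refl
    antisym (c ◅ ε)     (d ◅ _) = ⊥-elim (no-chain c d)
    antisym (c ◅ d ◅ _) _       = ⊥-elim (no-chain c d)

  graphPoset : LabelledPoset 2 (a ⊔ ℓ) (a ⊔ ℓ) (a ⊔ ℓ)
  graphPoset = record
    { poset = record
      { Carrier        = Point
      ; _≈_            = _≡_
      ; _≤_            = Star Cover
      ; isPartialOrder = record
        { isPreorder = Starₚ.isPreorder Cover
        ; antisym    = antisym
        }
      }
    ; label      = proj₂
    ; label-cong = cong proj₂
    }

  private
    open module P = LabelledPoset graphPoset using (_≤_)
    open NonStrictToStrict _≡_ _≤_ using (_<_)

  -- The generating relation is exactly the covering relation of the order.

  Cover⇔covering : ∀ {x y} → Cover x y ⇔ (x < y × ¬ (∃[ z ] (x < z × z < y)))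
  Cover⇔covering = mk⇔ to from
    where
    to : ∀ {x y} → Cover x y → x < y × ¬ (∃[ z ] (x < z × z < y))
    to {x} {y} c = (c ◅ ε , λ { refl → irreflexive c }) , between
      where
      between : ¬ (∃[ z ] (x < z × z < y))
      between (_ , (ε     , x≢z) , _)               = x≢z refl
      between (_ , (_ ◅ _ , _)   , (ε , z≢y))       = z≢y refl
      between (_ , (d ◅ ε , _)   , (e ◅ _ , _))     = no-chain d e
      between (_ , (d ◅ e ◅ _ , _) , (_ ◅ _ , _))   = no-chain d e

    from : ∀ {x y} → x < y × ¬ (∃[ z ] (x < z × z < y)) → Cover x y
    from ((ε         , x≢y) , _) = ⊥-elim (x≢y refl)
    from ((c ◅ ε     , _)   , _) = c
    from ((c ◅ d ◅ _ , _)   , _) = ⊥-elim (no-chain c d)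

{-# OPTIONS --safe #-}
-- The only covers that change the label are (v,0) < (v,1) for vertices v and
-- (e,1) < (e,0) for edges e, and no two covers compose.  So a 2-poset homomorphism
-- sends both copies of a vertex to the copies of one vertex, and both copies of an
-- edge to the copies of one edge; the other covers make it respect endpoints.
module Submission where

open import Defs
open import Data.Fin.Patterns using (0F; 1F)
open import Data.Product.Base using (∃-syntax; _×_; _,_; proj₁; proj₂)
open import Data.Sum.Base using (inj₁; inj₂)
open import Function.Bundles using (_⇔_; mk⇔)
open import Level using (Level)
open import Relation.Binary.Construct.Closure.ReflexiveTransitive using (Star; ε; _◅_; gmap)
open import Relation.Binary.PropositionalEquality using (_≡_; refl; sym; cong; subst₂)

private
  variable
    a ℓ b m : Level

module _ (G : Digraph a ℓ) where
  open Digraph G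

  -- The label conditions are equations rather than fixed indices because the labels of image points
  -- are known only propositionally, through `label-preserving`.
  0≤1⇒vertex : ∀ {x y} → Star (Cover G) x y → proj₂ x ≡ 0F → proj₂ y ≡ 1F →
               ∃[ v ] (x ≡ (inj₁ v , 0F) × y ≡ (inj₁ v , 1F))
  0≤1⇒vertex ε                    refl ()
  0≤1⇒vertex (vertex v ◅ ε)       _    _  = v , refl , refl
  0≤1⇒vertex (edge _ ◅ _)         ()   _
  0≤1⇒vertex (source _ ◅ ε)       _    ()
  0≤1⇒vertex (target _ ◅ _)       ()   _
  0≤1⇒vertex (vertex _ ◅ () ◅ _)
  0≤1⇒vertex (source _ ◅ () ◅ _)

  1≤0⇒edge : ∀ {x y} → Star (Cover G) x y → proj₂ x ≡ 1F → proj₂ y ≡ 0F →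
             ∃[ e ] (x ≡ (inj₂ e , 1F) × y ≡ (inj₂ e , 0F))
  1≤0⇒edge ε                    refl ()
  1≤0⇒edge (vertex _ ◅ _)       ()   _
  1≤0⇒edge (edge e ◅ ε)         _    _  = e , refl , refl
  1≤0⇒edge (source _ ◅ _)       ()   _
  1≤0⇒edge (target _ ◅ ε)       _    ()
  1≤0⇒edge (edge _ ◅ () ◅ _)
  1≤0⇒edge (target _ ◅ () ◅ _)

  -- Each chain must be a single cover, `source` or `target`; sharing `e` makes them the two ends of
  -- one edge.
  source-target⇒E : ∀ {u v e} → Star (Cover G) (inj₁ u , 0F) (inj₂ e , 0F) →
                    Star (Cover G) (inj₂ e , 1F) (inj₁ v , 1F) → E u v
  source-target⇒E (source e ◅ ε)        (target .e ◅ ε) = e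
  source-target⇒E (source _ ◅ ε)        (edge _ ◅ () ◅ _)
  source-target⇒E (source _ ◅ ε)        (target _ ◅ () ◅ _)
  source-target⇒E (vertex _ ◅ () ◅ _)
  source-target⇒E (source _ ◅ () ◅ _)

module _ {G : Digraph a ℓ} {H : Digraph b m} where
  graphPoset-map : GraphHomomorphism G H →
                   LabelledPosetHomomorphism (graphPoset G) (graphPoset H)
  graphPoset-map h = record
    { posetHomomorphism = record
      { ⟦_⟧                 = point
      ; isOrderHomomorphism = record { cong = cong point ; mono = gmap point cover }
      }
    -- `point` reduces only once its argument is split into vertex or edge.
    ; label-preserving = λ where
        (inj₁ _ , _) → refl
        (inj₂ _ , _) → refl
    }
    where
    open GraphHomomorphism h renaming (edge to edge⁺)

    point : Point G → Point H
    point (inj₁ v , i)             = inj₁ ⟦ v ⟧ , i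
    point (inj₂ ((u , v) , e) , i) = inj₂ ((⟦ u ⟧ , ⟦ v ⟧) , edge⁺ e) , i

    cover : ∀ {x y} → Cover G x y → Cover H (point x) (point y)
    cover (vertex v) = vertex ⟦ v ⟧
    cover (edge _)   = edge _
    cover (source e) = source (edge⁺ e)
    cover (target e) = target (edge⁺ e)

  graphPoset-unmap : LabelledPosetHomomorphism (graphPoset G) (graphPoset H) →
                     GraphHomomorphism G H
  graphPoset-unmap h = record
    { ⟦_⟧  = λ v → proj₁ (onVertex v)
    ; edge = λ {u} {v} e →
        -- Both edge equations come from one call of `onEdge`, so the images of the `source` and
        -- `target` covers meet the same edge of `H`.
        let _ , u₀≡ , _   = onVertex u
            _ , _   , v₁≡ = onVertex v
            _ , e₁≡ , e₀≡ = onEdge (_ , e)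
        in source-target⇒E H (subst₂ (Star (Cover H)) u₀≡ e₀≡ (mono (source e ◅ ε)))
                             (subst₂ (Star (Cover H)) e₁≡ v₁≡ (mono (target e ◅ ε)))
    }
    where
    open LabelledPosetHomomorphism h

    -- A single `w` serves both labels, so the vertex map is the same whether a vertex occurs as a
    -- source (label 0) or as a target (label 1).
    onVertex : ∀ v → ∃[ w ] (⟦ inj₁ v , 0F ⟧ ≡ (inj₁ w , 0F) × ⟦ inj₁ v , 1F ⟧ ≡ (inj₁ w , 1F))
    onVertex v = 0≤1⇒vertex H (mono (vertex v ◅ ε))
                   (sym (label-preserving _)) (sym (label-preserving _))

    onEdge : ∀ e → ∃[ f ] (⟦ inj₂ e , 1F ⟧ ≡ (inj₂ f , 1F) × ⟦ inj₂ e , 0F ⟧ ≡ (inj₂ f , 0F))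
    onEdge e = 1≤0⇒edge H (mono (edge e ◅ ε))
                 (sym (label-preserving _)) (sym (label-preserving _))

proposition3p1 : ∀ {a ℓ b m} (G : Digraph a ℓ) (H : Digraph b m) →
    GraphHomomorphism G H ⇔ LabelledPosetHomomorphism (graphPoset G) (graphPoset H)
proposition3p1 G H = mk⇔ graphPoset-map graphPoset-unmap
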